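{- Let $T\subseteq S$ and let $G$ be a finite nontrivial abelian group. If there exists $n_0\in\mathbb{N}$ such that $\langle S_n(T)\rangle\cong G$ for every $n\ge n_0$, then $G\cong\mathbb{Z}_2$ or $G\cong\mathbb{Z}_2\times\mathbb{Z}_2$.
   Context: $S_n$ is the symmetric group on $[n]$, $S=\bigcup_{n\ge0}S_n$. A permutation $\pi\in S_n$ contains the pattern $\tau\in S_k$ if some subsequence of $\pi$ of length $k$ is order-isomorphic to $\tau$; otherwise it avoids $\tau$. For $T\subseteq S$, $S_n(T)$ is the set of permutations in $S_n$ avoiding every pattern in $T$, and $\langle S_n(T)\rangle$ is the subgroup of $S_n$ it generates. $\mathbb{Z}_2$ is the cyclic group of order 2. -}

module Defs where

open import Level using (Level; 0ℓ; _⊔_)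
open import Data.Nat using (ℕ)
open import Data.Bool using (Bool; true; false; _xor_)
open import Data.Bool.Properties using (xor-assoc; xor-comm; xor-identityˡ; xor-identityʳ; xor-same)
open import Data.Fin using (Fin; _<_)
open import Data.Fin.Permutation using (Permutation′; _⟨$⟩ʳ_; _⟨$⟩ˡ_; _∘ₚ_; id; flip; inverseˡ; inverseʳ)
open import Data.Product using (Σ; ∃; ∃-syntax; _×_; _,_; proj₁; proj₂)
open import Function.Bundles using (_⇔_)
open import Function.Definitions using (Injective; Surjective)
open import Relation.Nullary using (¬_)
open import Relation.Binary.PropositionalEquality as ≡ using (_≡_; refl; cong; trans; sym)
open import Algebra.Bundles using (Group; AbelianGroup)
open import Algebra.Morphism.Structures using (module GroupMorphisms)
import Algebra.Construct.DirectProduct as DP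

-- Permutations of [n] are 'Permutation′ n' (bijections Fin n ↔ Fin n),
-- compared pointwise.  Composition: (π · σ)(i) = π(σ(i)).

_·_ : {n : ℕ} → Permutation′ n → Permutation′ n → Permutation′ n
π · σ = σ ∘ₚ π

_≋_ : {n : ℕ} → Permutation′ n → Permutation′ n → Set
π ≋ σ = ∀ i → π ⟨$⟩ʳ i ≡ σ ⟨$⟩ʳ i

Contains : {n k : ℕ} → Permutation′ n → Permutation′ k → Set
Contains {n} {k} π τ =
  Σ (Fin k → Fin n) λ f → ((∀ (i j : Fin k) → i < j → f i < f j)
         × (∀ (i j : Fin k) → (τ ⟨$⟩ʳ i < τ ⟨$⟩ʳ j) ⇔ (π ⟨$⟩ʳ f i < π ⟨$⟩ʳ f j)))

PatternSet : Set₁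
PatternSet = (k : ℕ) → Permutation′ k → Set

Avoids : PatternSet → {n : ℕ} → Permutation′ n → Set
Avoids T π = ∀ k (τ : Permutation′ k) → T k τ → ¬ Contains π τ

data Gen (T : PatternSet) (n : ℕ) : Permutation′ n → Set where
  gen : ∀ {π} → Avoids T π → Gen T n π
  one : Gen T n id
  mul : ∀ {π σ} → Gen T n π → Gen T n σ → Gen T n (π · σ)
  inv : ∀ {π} → Gen T n π → Gen T n (flip π)

private
  ⁻¹-cong′ : {n : ℕ} (π σ : Permutation′ n) → π ≋ σ → flip π ≋ flip σ
  ⁻¹-cong′ π σ p j =
    trans (cong (π ⟨$⟩ˡ_) (sym (trans (p (σ ⟨$⟩ˡ j)) (inverseʳ σ))))
          (inverseˡ π)

genGroup : PatternSet → ℕ → Group 0ℓ 0ℓ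
genGroup T n = record
  { Carrier = Σ (Permutation′ n) (Gen T n)
  ; _≈_ = λ x y → proj₁ x ≋ proj₁ y
  ; _∙_ = λ x y → (proj₁ x · proj₁ y) , mul (proj₂ x) (proj₂ y)
  ; ε = id , one
  ; _⁻¹ = λ x → flip (proj₁ x) , inv (proj₂ x)
  ; isGroup = record
    { isMonoid = record
      { isSemigroup = record
        { isMagma = record
          { isEquivalence = record
            { refl = λ _ → refl
            ; sym = λ p i → sym (p i)
            ; trans = λ p q i → trans (p i) (q i) }
          ; ∙-cong = λ {x} {y} {u} {v} p q i →
              trans (cong (proj₁ x ⟨$⟩ʳ_) (q i)) (p (proj₁ v ⟨$⟩ʳ i)) }
        ; assoc = λ _ _ _ _ → refl }
      ; identity = (λ _ _ → refl) , (λ _ _ → refl) }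
    ; inverse = (λ x i → inverseˡ (proj₁ x)) , (λ x i → inverseʳ (proj₁ x))
    ; ⁻¹-cong = λ {x} {y} p → ⁻¹-cong′ (proj₁ x) (proj₁ y) p } }

_≅ᵍ_ : ∀ {a b ℓ₁ ℓ₂} → Group a ℓ₁ → Group b ℓ₂ → Set (a ⊔ b ⊔ ℓ₁ ⊔ ℓ₂)
G ≅ᵍ H = ∃[ φ ] GroupMorphisms.IsGroupIsomorphism (Group.rawGroup G) (Group.rawGroup H) φ

FiniteGroup : ∀ {a ℓ} → Group a ℓ → Set (a ⊔ ℓ)
FiniteGroup G = ∃[ m ] Σ (Fin m → Group.Carrier G) λ f → (Injective _≡_ (Group._≈_ G) f
                             × Surjective _≡_ (Group._≈_ G) f)

NontrivialGroup : ∀ {a ℓ} → Group a ℓ → Set (a ⊔ ℓ)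
NontrivialGroup G = ∃[ g ] ¬ (Group._≈_ G g (Group.ε G))

ℤ₂ : AbelianGroup 0ℓ 0ℓ
ℤ₂ = record
  { Carrier = Bool
  ; _≈_ = _≡_
  ; _∙_ = _xor_
  ; ε = false
  ; _⁻¹ = λ x → x
  ; isAbelianGroup = record
    { isGroup = record
      { isMonoid = record
        { isSemigroup = record
          { isMagma = record { isEquivalence = ≡.isEquivalence ; ∙-cong = ≡.cong₂ _xor_ }
          ; assoc = xor-assoc }
        ; identity = xor-identityˡ , xor-identityʳ }
      ; inverse = xor-same , xor-same
      ; ⁻¹-cong = λ p → p }
    ; comm = xor-comm } }

ℤ₂×ℤ₂ : AbelianGroup 0ℓ 0ℓ
ℤ₂×ℤ₂ = DP.abelianGroup ℤ₂ ℤ₂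

{-# OPTIONS --safe #-}

-- Let H n = ⟨S_n(T)⟩ and take n ≥ n₀ with n > |G|.  If π avoids T and has length n + 1,
-- its one-point deletions lie in the abelian group H n.  Deleting either of two adjacent
-- entries with values p < q + 1 gives patterns whose quotient is the cycle (p, p+1, …, q);
-- when p < q, every element of H n commutes with this cycle and so preserves [p, q].
-- Applied to all deletions of π this forces q = p + 1 with p = 0 or q = n - 1 (0-based):
-- the only other possibility, a full n-cycle, has too large an order.  So the consecutive
-- entries of π differ by 1 except for an initial 1 0 2 or a final n-2 n n-1, and π is the
-- identity, the reversal, or a product of the transpositions of the two lowest and of the
-- two highest points.  The reversal does not coexist with a cycle [p, p + 1], hence
-- H (n + 1) embeds in a Klein four-group of permutations.

module Submission where

open import Defs
open import Data.Nat using (ℕ; zero; suc; _+_; _∸_; _≤_; _<_; _≥_; z≤n; s≤s; _<?_; _≤?_)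
open import Data.Nat.Properties
open import Data.Bool using (Bool; true; false; _xor_)
open import Data.Bool.Properties using (xor-same)
open import Data.Fin using (Fin; toℕ; fromℕ<; punchIn; punchOut) renaming (zero to fzero; suc to fsuc)
import Data.Fin as Fin
open import Data.Fin.Patterns using (0F; 1F; 2F; 3F)
import Data.Fin.Properties as FinP
open import Data.Fin.Permutation using (Permutation′; _⟨$⟩ʳ_; id; flip; inverseˡ; inverseʳ; remove; reverse; punchIn-permute)
open import Data.Product using (Σ; ∃-syntax; _×_; _,_; proj₁; proj₂)
open import Data.Sum using (_⊎_; inj₁; inj₂; fromInj₁)
open import Data.Empty using (⊥; ⊥-elim)
open import Function.Base using (_∘_)
open import Function.Bundles using (mk⇔; Equivalence)
open import Relation.Nullary using (¬_; Dec; yes; no; contradiction; ¬?; _×-dec_)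
open import Relation.Nullary.Decidable using (map′)
open import Relation.Binary.Definitions using (tri<; tri≈; tri>)
open import Relation.Binary.PropositionalEquality using (_≡_; _≢_; refl; sym; trans; cong; cong₂; subst; module ≡-Reasoning)
open import Algebra.Bundles using (Group; AbelianGroup)
open import Algebra.Morphism.Structures using (module GroupMorphisms)

-- Permutations as functions on ℕ, and the removal of one point

by-toℕ : ∀ {ℓ} n (P : ℕ → Set ℓ) → (∀ (i : Fin n) → P (toℕ i)) → (∀ {x} → ¬ x < n → P x) → ∀ x → P x
by-toℕ n P inside outside x with x <? n
... | yes x<n = subst P (FinP.toℕ-fromℕ< x<n) (inside (fromℕ< x<n))
... | no  x≮n = outside x≮n

-- Permutations of Fin n become permutations of ℕ that fix every x ≥ n, so that
-- composition and inversion need no bounds.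
abstract
  app : ∀ {n} → Permutation′ n → ℕ → ℕ
  app {n} π x with x <? n
  ... | yes x<n = toℕ (π ⟨$⟩ʳ fromℕ< x<n)
  ... | no  _   = x

  app-outside : ∀ {n} (π : Permutation′ n) {x} → ¬ x < n → app π x ≡ x
  app-outside {n} π {x} x≮n with x <? n
  ... | yes x<n = contradiction x<n x≮n
  ... | no  _   = refl

  app-toℕ : ∀ {n} (π : Permutation′ n) i → app π (toℕ i) ≡ toℕ (π ⟨$⟩ʳ i)
  app-toℕ {n} π i with toℕ i <? n
  ... | yes p = cong (λ j → toℕ (π ⟨$⟩ʳ j)) (FinP.fromℕ<-toℕ i p)
  ... | no ¬p = contradiction (FinP.toℕ<n i) ¬p

app-· : ∀ {n} (π σ : Permutation′ n) x → app (π · σ) x ≡ app π (app σ x)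
app-· {n} π σ = by-toℕ n _
  (λ i → trans (app-toℕ (π · σ) i)
        (sym (trans (cong (app π) (app-toℕ σ i)) (app-toℕ π (σ ⟨$⟩ʳ i)))))
  (λ x≮n → trans (app-outside (π · σ) x≮n)
        (sym (trans (cong (app π) (app-outside σ x≮n)) (app-outside π x≮n))))

app-id : ∀ {n} x → app (id {n}) x ≡ x
app-id {n} = by-toℕ n _ (app-toℕ id) (app-outside id)

app-cong : ∀ {n} {π σ : Permutation′ n} → π ≋ σ → ∀ x → app π x ≡ app σ x
app-cong {n} {π} {σ} π≋σ = by-toℕ n _
  (λ i → trans (app-toℕ π i) (trans (cong toℕ (π≋σ i)) (sym (app-toℕ σ i))))
  (λ x≮n → trans (app-outside π x≮n) (sym (app-outside σ x≮n)))

app-reflects-≋ : ∀ {n} {π σ : Permutation′ n} → (∀ x → app π x ≡ app σ x) → π ≋ σ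
app-reflects-≋ {π = π} {σ} eq i =
  FinP.toℕ-injective (trans (sym (app-toℕ π i)) (trans (eq (toℕ i)) (app-toℕ σ i)))

app-flipˡ : ∀ {n} (π : Permutation′ n) x → app (flip π) (app π x) ≡ x
app-flipˡ {n} π x = trans (sym (app-· (flip π) π x))
  (trans (app-cong {π = flip π · π} {σ = id} (λ i → inverseˡ π) x) (app-id {n} x))

app-flipʳ : ∀ {n} (π : Permutation′ n) x → app π (app (flip π) x) ≡ x
app-flipʳ {n} π x = trans (sym (app-· π (flip π) x))
  (trans (app-cong {π = π · flip π} {σ = id} (λ i → inverseʳ π) x) (app-id {n} x))

app-injective : ∀ {n} (π : Permutation′ n) {x y} → app π x ≡ app π y → x ≡ y
app-injective π {x} {y} eq =
  trans (sym (app-flipˡ π x)) (trans (cong (app (flip π)) eq) (app-flipˡ π y))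

app-< : ∀ {n} (π : Permutation′ n) {x} → x < n → app π x < n
app-< {n} π {x} = by-toℕ n (λ x → x < n → app π x < n)
  (λ i _ → subst (_< n) (sym (app-toℕ π i)) (FinP.toℕ<n _))
  (λ x≮n x<n → contradiction x<n x≮n) x

-- del j renumbers the elements of ℕ ∖ {j} in increasing order.
del : ℕ → ℕ → ℕ
del j       zero    = zero
del zero    (suc z) = z
del (suc j) (suc z) = suc (del j z)

del-≤ : ∀ {j z} → z ≤ j → del j z ≡ z
del-≤ z≤n       = refl
del-≤ (s≤s z≤j) = cong suc (del-≤ z≤j)

del-> : ∀ {j z} → j ≤ z → del j (suc z) ≡ z
del-> {zero}  _           = refl
del-> {suc j} (s≤s j≤z) = cong suc (del-> j≤z)

toℕ-punchOut : ∀ {n} {i j : Fin (suc n)} (i≢j : i ≢ j) → toℕ (punchOut i≢j) ≡ del (toℕ i) (toℕ j)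
toℕ-punchOut {i = fzero}          {fzero}  i≢j = contradiction refl i≢j
toℕ-punchOut {i = fzero}          {fsuc j} _   = refl
toℕ-punchOut {suc n} {fsuc i}     {fzero}  _   = refl
toℕ-punchOut {suc n} {fsuc i}     {fsuc j} i≢j = cong suc (toℕ-punchOut (i≢j ∘ cong fsuc))

toℕ-remove : ∀ {n} (i : Fin (suc n)) (π : Permutation′ (suc n)) k →
  toℕ (remove i π ⟨$⟩ʳ k) ≡ del (toℕ (π ⟨$⟩ʳ i)) (toℕ (π ⟨$⟩ʳ punchIn i k))
toℕ-remove i π k = toℕ-punchOut {i = π ⟨$⟩ʳ i} {j = π ⟨$⟩ʳ punchIn i k} _

app-remove : ∀ {n} (i : Fin (suc n)) (π : Permutation′ (suc n)) z → z ≢ toℕ i →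
  app (remove i π) (del (toℕ i) z) ≡ del (toℕ (π ⟨$⟩ʳ i)) (app π z)
app-remove {n} i π = by-toℕ (suc n) _ inside outside
  where
  open ≡-Reasoning
  ρ = remove i π
  inside : ∀ k → toℕ k ≢ toℕ i → app ρ (del (toℕ i) (toℕ k)) ≡ del (toℕ (π ⟨$⟩ʳ i)) (app π (toℕ k))
  inside k k≢i = begin
    app ρ (del (toℕ i) (toℕ k))                                  ≡⟨ cong (app ρ) (toℕ-punchOut i≢k) ⟨
    app ρ (toℕ (punchOut i≢k))                                   ≡⟨ app-toℕ ρ _ ⟩
    toℕ (ρ ⟨$⟩ʳ punchOut i≢k)                                    ≡⟨ toℕ-remove i π _ ⟩
    del (toℕ (π ⟨$⟩ʳ i)) (toℕ (π ⟨$⟩ʳ punchIn i (punchOut i≢k))) ≡⟨ cong (λ j → del _ (toℕ (π ⟨$⟩ʳ j))) (FinP.punchIn-punchOut i≢k) ⟩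
    del (toℕ (π ⟨$⟩ʳ i)) (toℕ (π ⟨$⟩ʳ k))                        ≡⟨ cong (del _) (app-toℕ π k) ⟨
    del (toℕ (π ⟨$⟩ʳ i)) (app π (toℕ k))                         ∎
    where
    i≢k : i ≢ k
    i≢k i≡k = k≢i (sym (cong toℕ i≡k))
  -- The deleted position and the deleted value are both at most n, so beyond the support both
  -- renumberings subtract 1.
  outside : ∀ {x} → ¬ x < suc n → x ≢ toℕ i → app ρ (del (toℕ i) x) ≡ del (toℕ (π ⟨$⟩ʳ i)) (app π x)
  outside {zero}  x≮ _ = contradiction (s≤s z≤n) x≮
  outside {suc x} x≮ _ = begin
    app ρ (del (toℕ i) (suc x))            ≡⟨ cong (app ρ) (del-> (≤-trans (≤-pred (FinP.toℕ<n i)) n≤x)) ⟩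
    app ρ x                                ≡⟨ app-outside ρ (≤⇒≯ n≤x) ⟩
    x                                      ≡⟨ del-> (≤-trans (≤-pred (FinP.toℕ<n (π ⟨$⟩ʳ i))) n≤x) ⟨
    del (toℕ (π ⟨$⟩ʳ i)) (suc x)           ≡⟨ cong (del _) (app-outside π x≮) ⟨
    del (toℕ (π ⟨$⟩ʳ i)) (app π (suc x))   ∎
    where
    n≤x : n ≤ x
    n≤x = ≤-pred (≮⇒≥ x≮)

-- Deletions and commutation

punchIn-mono-< : ∀ {n} (i : Fin (suc n)) {j k} → j Fin.< k → punchIn i j Fin.< punchIn i k
punchIn-mono-< i j<k = ≰⇒> (λ le → <⇒≱ j<k (FinP.punchIn-cancel-≤ i _ _ le))

punchIn-cancel-< : ∀ {n} (i : Fin (suc n)) {j k} → punchIn i j Fin.< punchIn i k → j Fin.< k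
punchIn-cancel-< i lt = ≰⇒> (λ k≤j → <⇒≱ lt (FinP.punchIn-mono-≤ i _ _ k≤j))

contains-remove : ∀ {n k} (i : Fin (suc n)) (π : Permutation′ (suc n)) (τ : Permutation′ k) →
  Contains (remove i π) τ → Contains π τ
contains-remove i π τ (f , mono , iso) =
  punchIn i ∘ f , (λ j k j<k → punchIn-mono-< i (mono j k j<k)) , λ j k → mk⇔
    (λ lt → subst₂< (sym (pi (f j))) (sym (pi (f k)))
              (punchIn-mono-< (π ⟨$⟩ʳ i) (Equivalence.to (iso j k) lt)))
    (λ lt → Equivalence.from (iso j k)
              (punchIn-cancel-< (π ⟨$⟩ʳ i) (subst₂< (pi (f j)) (pi (f k)) lt)))
  where
  pi = punchIn-permute π i
  subst₂< : ∀ {n} {a b c d : Fin n} → a ≡ b → c ≡ d → a Fin.< c → b Fin.< d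
  subst₂< refl refl lt = lt

avoids-remove : ∀ {T n} (i : Fin (suc n)) {π : Permutation′ (suc n)} → Avoids T π → Avoids T (remove i π)
avoids-remove i {π} av k τ Tτ c = av k τ Tτ (contains-remove i π τ c)

-- In cycle notation this is (p, p+1, ..., q), extended to all of ℕ by fixed points; for p = q it is
-- the identity.
record IsCycle (p q : ℕ) (c : ℕ → ℕ) : Set where
  field
    below : ∀ {x} → x < p → c x ≡ x
    step  : ∀ {x} → p ≤ x → x < q → c x ≡ suc x
    wrap  : c q ≡ p
    above : ∀ {x} → q < x → c x ≡ x

Between : ℕ → ℕ → ℕ → Set
Between p q x = p ≤ x × x ≤ q

moved⇒between : ∀ {p q c} → IsCycle p q c → ∀ {x} → c x ≢ x → Between p q x
moved⇒between cyc cx≢x =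
  ≮⇒≥ (cx≢x ∘ IsCycle.below cyc) , ≮⇒≥ (cx≢x ∘ IsCycle.above cyc)

between⇒moved : ∀ {p q c} → IsCycle p q c → p < q → ∀ {x} → Between p q x → c x ≢ x
between⇒moved {p} {q} cyc p<q {x} (p≤x , x≤q) cx≡x with m≤n⇒m<n∨m≡n x≤q
... | inj₁ x<q  = 1+n≢n (trans (sym (IsCycle.step cyc p≤x x<q)) cx≡x)
... | inj₂ refl = <⇒≢ p<q (trans (sym (IsCycle.wrap cyc)) cx≡x)

module _ {p q c} (cyc : IsCycle p q c) (p<q : p < q)
         {n} (h : Permutation′ n) (comm : ∀ x → app h (c x) ≡ c (app h x)) where

  -- A permutation commuting with `c` permutes the points moved by `c`. For p < q these are exactly
  -- the points of [p, q].
  commuting-preserves : ∀ {x} → Between p q x → Between p q (app h x)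
  commuting-preserves {x} b = moved⇒between cyc
    (λ eq → between⇒moved cyc p<q b (app-injective h (trans (comm x) eq)))

  commuting-reflects : ∀ {x} → Between p q (app h x) → Between p q x
  commuting-reflects {x} b = moved⇒between cyc
    (λ eq → between⇒moved cyc p<q b (trans (sym (comm x)) (cong (app h) eq)))

Commuting : PatternSet → ℕ → Set
Commuting T n = ∀ {x y : Permutation′ n} → Gen T n x → Gen T n y → (x · y) ≋ (y · x)

app-comm : ∀ {T n} → Commuting T n → ∀ {x y} → Gen T n x → Gen T n y → ∀ z → app x (app y z) ≡ app y (app x z)
app-comm comm {x} {y} gx gy z =
  trans (sym (app-· x y z)) (trans (app-cong {π = x · y} {σ = y · x} (comm gx gy) z) (app-· y x z))

abstract
  -- Avoidance passes to patterns, so each one-point deletion of an avoider is a generator one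
  -- length lower. The equation describes it without any `Fin` arithmetic.
  deletion : ∀ {T n} {π : Permutation′ (suc n)} → Avoids T π → ∀ {j} → j ≤ n →
    Σ (Permutation′ n) λ ρ → Gen T n ρ × (∀ {z} → z ≢ j → app ρ (del j z) ≡ del (app π j) (app π z))
  deletion {T} {n} {π} av {j} j≤n = remove i π , gen (avoids-remove {T} i {π} av) , eq
    where
    i : Fin (suc n)
    i = fromℕ< (s≤s j≤n)
    toℕi : toℕ i ≡ j
    toℕi = FinP.toℕ-fromℕ< (s≤s j≤n)
    eq : ∀ {z} → z ≢ j → app (remove i π) (del j z) ≡ del (app π j) (app π z)
    eq {z} z≢j = trans (cong (λ j → app (remove i π) (del j z)) (sym toℕi))
      (trans (app-remove i π z (λ e → z≢j (trans e toℕi)))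
        (cong (λ v → del v (app π z)) (trans (sym (app-toℕ π i)) (cong (app π) toℕi))))

Adjacent : ℕ → ℕ → Set
Adjacent s t = s ≡ suc t ⊎ t ≡ suc s

adjacent-sym : ∀ {s t} → Adjacent s t → Adjacent t s
adjacent-sym (inj₁ e) = inj₂ e
adjacent-sym (inj₂ e) = inj₁ e

del-self-suc : ∀ s → del s (suc s) ≡ del (suc s) s
del-self-suc s = trans (del-> ≤-refl) (sym (del-≤ (n≤1+n s)))

del-suc : ∀ s {z} → z ≢ s → z ≢ suc s → del s z ≡ del (suc s) z
del-suc s {z} z≢s z≢1+s with z ≤? s
... | yes z≤s = trans (del-≤ z≤s) (sym (del-≤ (m≤n⇒m≤1+n z≤s)))
del-suc s {zero} z≢s z≢1+s | no z≰s = contradiction z≤n z≰s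
del-suc s {suc z} z≢s z≢1+s | no z≰s =
  trans (del-> s≤z) (sym (del-> (≤∧≢⇒< s≤z (z≢1+s ∘ cong suc ∘ sym))))
  where s≤z = ≤-pred (≰⇒> z≰s)

del-adjacent : ∀ {s t} → Adjacent s t → ∀ {z} → z ≢ s → z ≢ t → del s z ≡ del t z
del-adjacent (inj₁ refl) z≢s z≢t = sym (del-suc _ z≢t z≢s)
del-adjacent (inj₂ refl) z≢s z≢t = del-suc _ z≢s z≢t

del-adjacent-swap : ∀ {s t} → Adjacent s t → del s t ≡ del t s
del-adjacent-swap {t = t} (inj₁ refl) = sym (del-self-suc t)
del-adjacent-swap {s} (inj₂ refl) = del-self-suc s

adjacent-≢ : ∀ {s t} → Adjacent s t → s ≢ t
adjacent-≢ (inj₁ refl) e = 1+n≢n e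
adjacent-≢ (inj₂ refl) e = 1+n≢n (sym e)

-- Deleting the entry at position s and deleting the entry at the adjacent position t
-- give two patterns ρ, σ whose quotient is this cycle.
quotient-cycle : ∀ {n} {π : Permutation′ (suc n)} {s t p q} (ρ σ : Permutation′ n) →
  (∀ {z} → z ≢ s → app ρ (del s z) ≡ del (app π s) (app π z)) →
  (∀ {z} → z ≢ t → app σ (del t z) ≡ del (app π t) (app π z)) →
  Adjacent s t → app π s ≡ p → app π t ≡ suc q → p ≤ q → IsCycle p q (app (σ · flip ρ))
quotient-cycle {n} {π} {s} {t} {p} {q} ρ σ delρ delσ adj refl πt p≤q = record
  { below = λ x<p → trans (cong (app c) (sym (del-≤ (<⇒≤ x<p))))
      (trans (generic (<⇒≢ x<p) (<⇒≢ (<-trans x<p (s≤s p≤q))))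
        (del-≤ (≤-trans (<⇒≤ x<p) (m≤n⇒m≤1+n p≤q))))
  ; step  = λ p≤x x<q → trans (cong (app c) (sym (del-> p≤x)))
      (trans (generic (>⇒≢ (s≤s p≤x)) (<⇒≢ (s≤s x<q))) (del-≤ (s≤s (<⇒≤ x<q))))
  ; wrap  = trans (cong (app c) (sym (del-> p≤q))) (trans special (del-≤ (m≤n⇒m≤1+n p≤q)))
  ; above = λ q<x → trans (cong (app c) (sym (del-> (≤-trans p≤q (<⇒≤ q<x)))))
      (trans (generic (>⇒≢ (s≤s (≤-trans p≤q (<⇒≤ q<x)))) (>⇒≢ (s≤s q<x))) (del-> q<x)) }
  where
  open ≡-Reasoning
  c = σ · flip ρ
  c∘ρ : ∀ x → app c (app ρ x) ≡ app σ x
  c∘ρ x = trans (app-· σ (flip ρ) (app ρ x)) (cong (app σ) (app-flipˡ ρ x))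
  -- A value y that neither deletion removes sits at the same place in both patterns; only its name
  -- changes, from `del p y` to `del (suc q) y`.
  generic : ∀ {y} → y ≢ p → y ≢ suc q → app c (del p y) ≡ del (suc q) y
  generic {y} y≢p y≢w = begin
    app c (del p y)                ≡⟨ cong (λ u → app c (del p u)) (app-flipʳ π y) ⟨
    app c (del p (app π z))        ≡⟨ cong (app c) (delρ z≢s) ⟨
    app c (app ρ (del s z))        ≡⟨ c∘ρ _ ⟩
    app σ (del s z)                ≡⟨ cong (app σ) (del-adjacent adj z≢s z≢t) ⟩
    app σ (del t z)                ≡⟨ delσ z≢t ⟩
    del (app π t) (app π z)        ≡⟨ cong₂ del πt (app-flipʳ π y) ⟩
    del (suc q) y                  ∎
    where
    z = app (flip π) y
    z≢s : z ≢ s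
    z≢s e = y≢p (trans (sym (app-flipʳ π y)) (cong (app π) e))
    z≢t : z ≢ t
    z≢t e = y≢w (trans (sym (app-flipʳ π y)) (trans (cong (app π) e) πt))
  -- Each pattern keeps one of the two adjacent entries. Both kept entries end up at the same
  -- position, so `c` sends the name of one to that of the other.
  special : app c (del p (suc q)) ≡ del (suc q) p
  special = begin
    app c (del p (suc q))          ≡⟨ cong (λ u → app c (del p u)) πt ⟨
    app c (del p (app π t))        ≡⟨ cong (app c) (delρ (adjacent-≢ adj ∘ sym)) ⟨
    app c (app ρ (del s t))        ≡⟨ c∘ρ _ ⟩
    app σ (del s t)                ≡⟨ cong (app σ) (del-adjacent-swap adj) ⟩
    app σ (del t s)                ≡⟨ delσ (adjacent-≢ adj) ⟩
    del (app π t) p                ≡⟨ cong (λ w → del w p) πt ⟩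
    del (suc q) p                  ∎

abstract
  adjacent-cycle : ∀ {T n} {π : Permutation′ (suc n)} → Avoids T π →
    ∀ {s t p q} → s ≤ n → t ≤ n → Adjacent s t → app π s ≡ p → app π t ≡ suc q → p ≤ q →
    Σ (Permutation′ n) λ c → Gen T n c × IsCycle p q (app c)
  adjacent-cycle {T} {n} {π} av s≤n t≤n adj πs πt p≤q =
    let ρ , gρ , delρ = deletion {T} {n} {π} av s≤n
        σ , gσ , delσ = deletion {T} {n} {π} av t≤n
    in σ · flip ρ , mul gσ (inv gρ) , quotient-cycle {π = π} ρ σ delρ delσ adj πs πt p≤q

-- Steps of length at least 2

NoFullCycle : PatternSet → ℕ → Set
NoFullCycle T n = ∀ {c : Permutation′ n} {q} → Gen T n c → IsCycle 0 q (app c) → n ≢ suc q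

del-cases : ∀ v y → (del v y ≡ y × y ≤ v) ⊎ (∃[ y′ ] y ≡ suc y′ × v ≤ y′ × del v y ≡ y′)
del-cases v y with y ≤? v
... | yes y≤v = inj₁ (del-≤ y≤v , y≤v)
del-cases v zero    | no y≰v = contradiction z≤n y≰v
del-cases v (suc y) | no y≰v = inj₂ (y , refl , v≤y , del-> v≤y)
  where v≤y = ≤-pred (≰⇒> y≰v)

between-del⁻ : ∀ {p q} v y → Between p q (del v y) → Between p (suc q) y
between-del⁻ {p} {q} v y (p≤ , ≤q) with del-cases v y
... | inj₁ (e , _) = subst (p ≤_) e p≤ , m≤n⇒m≤1+n (subst (_≤ q) e ≤q)
... | inj₂ (y′ , refl , _ , e) = m≤n⇒m≤1+n (subst (p ≤_) e p≤) , s≤s (subst (_≤ q) e ≤q)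

-- Renumbering lowers a value by at most 1. Only p can thereby fall below the interval, and only q +
-- 1 can stay above it.
¬between-del⇒endpoint : ∀ {p q} v y → Between p (suc q) y → ¬ Between p q (del v y) → y ≡ p ⊎ y ≡ suc q
¬between-del⇒endpoint {p} {q} v y (p≤y , y≤1+q) ¬b with del-cases v y
... | inj₁ (e , _) with m≤n⇒m<n∨m≡n y≤1+q
...   | inj₁ y<1+q = contradiction (subst (Between p q) (sym e) (p≤y , ≤-pred y<1+q)) ¬b
...   | inj₂ y≡1+q = inj₂ y≡1+q
¬between-del⇒endpoint {p} {q} v y (p≤y , y≤1+q) ¬b | inj₂ (y′ , refl , _ , e) with m≤n⇒m<n∨m≡n p≤y
...   | inj₁ p<y = contradiction (subst (Between p q) (sym e) (≤-pred p<y , ≤-pred y≤1+q)) ¬b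
...   | inj₂ p≡y = inj₁ (sym p≡y)

-- The numbers p and q + 1 differ by at least 2, so they can be neither one and the same nor the two
-- adjacent positions s and t.
endpoints-not-adjacent : ∀ {s t p q} → Adjacent s t → p < q → p ≡ s ⊎ p ≡ t → suc q ≡ s ⊎ suc q ≡ t → ⊥
endpoints-not-adjacent adj        p<q (inj₁ refl) (inj₁ e)    = <⇒≢ (m≤n⇒m≤1+n p<q) (sym e)
endpoints-not-adjacent (inj₁ s≡)  p<q (inj₁ refl) (inj₂ refl) = <⇒≢ (≤-trans p<q (≤-trans (n≤1+n _) (n≤1+n _))) s≡
endpoints-not-adjacent (inj₂ t≡)  p<q (inj₁ refl) (inj₂ refl) = >⇒≢ p<q (suc-injective t≡)
endpoints-not-adjacent (inj₁ s≡)  p<q (inj₂ refl) (inj₁ refl) = >⇒≢ p<q (suc-injective s≡)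
endpoints-not-adjacent (inj₂ t≡)  p<q (inj₂ refl) (inj₁ refl) = <⇒≢ (≤-trans p<q (≤-trans (n≤1+n _) (n≤1+n _))) t≡
endpoints-not-adjacent adj        p<q (inj₂ refl) (inj₂ e)    = <⇒≢ (m≤n⇒m≤1+n p<q) (sym e)

module LongStep {T n} (comm : Commuting T n) (noFull : NoFullCycle T n)
                {π : Permutation′ (suc n)} (av : Avoids T π)
                {s t p q} (s≤n : s ≤ n) (t≤n : t ≤ n) (adj : Adjacent s t)
                (fs : app π s ≡ p) (ft : app π t ≡ suc q) (p<q : p < q) where

  private
    f g : ℕ → ℕ
    f = app π
    g = app (flip π)

    -- The interval spanned by the long step. It is one point longer than the support [p, q] of `c`,
    -- because π is one entry longer than its deletions.
    J : ℕ → Set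
    J = Between p (suc q)

    f≤ : ∀ {x} → x ≤ n → f x ≤ n
    f≤ x≤n = ≤-pred (app-< π (s≤s x≤n))

    q<n : q < n
    q<n = subst (_≤ n) ft (f≤ t≤n)

    cycle = adjacent-cycle {T} {n} {π} av s≤n t≤n adj fs ft (<⇒≤ p<q)
    cπ = proj₁ cycle
    gc = proj₁ (proj₂ cycle)
    cyc = proj₂ (proj₂ cycle)
    c : ℕ → ℕ
    c = app cπ

    at-s : ∀ {z} → f z ≡ p → z ≡ s
    at-s e = app-injective π (trans e (sym fs))

    at-t : ∀ {z} → f z ≡ suc q → z ≡ t
    at-t e = app-injective π (trans e (sym ft))

    -- Every deletion of π commutes with c and hence preserves [p, q].
    fwd : ∀ {j z} → j ≤ n → z ≢ j → Between p q (del j z) → Between p q (del (f j) (f z))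
    fwd j≤n z≢j b = let ρ , gρ , eq = deletion {T} {n} {π} av j≤n in
          subst (Between p q) (eq z≢j)
          (commuting-preserves cyc p<q ρ (app-comm comm gρ gc) b)

    bwd : ∀ {j z} → j ≤ n → z ≢ j → Between p q (del (f j) (f z)) → Between p q (del j z)
    bwd j≤n z≢j b = let ρ , gρ , eq = deletion {T} {n} {π} av j≤n in
          commuting-reflects cyc p<q ρ (app-comm comm gρ gc)
          (subst (Between p q) (sym (eq z≢j)) b)

    -- Some deletion always renumbers x into [p, q]: that of position n if x ≤ q, that of position 0
    -- if x = q + 1. Undoing the renumbering of the image costs at most one point at the top. The
    -- function `h` is left general to cover both `f` and its inverse.
    J-stable : (h : ℕ → ℕ) →
      (∀ {j z} → j ≤ n → z ≢ j → Between p q (del j z) → Between p q (del (h j) (h z))) →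
      ∀ {x} → J x → J (h x)
    J-stable h pres {x} (p≤x , x≤1+q) with m≤n⇒m<n∨m≡n x≤1+q
    ... | inj₁ (s≤s x≤q) = between-del⁻ (h n) (h x) (pres ≤-refl (<⇒≢ x<n)
            (subst (Between p q) (sym (del-≤ (<⇒≤ x<n))) (p≤x , x≤q)))
      where x<n = ≤-trans (s≤s x≤q) q<n
    ... | inj₂ refl = between-del⁻ (h 0) (h x) (pres z≤n (λ ()) (<⇒≤ p<q , ≤-refl))

    f-J : ∀ {x} → J x → J (f x)
    f-J = J-stable f fwd

    g-J : ∀ {x} → J x → J (g x)
    g-J = J-stable g λ {j} {z} j≤n z≢j b →
      bwd (≤-pred (app-< (flip π) (s≤s j≤n))) (λ e → z≢j (app-injective (flip π) e))
        (subst (Between p q) (sym (cong₂ del (app-flipʳ π j) (app-flipʳ π z))) b)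

    f-J⁻ : ∀ {x} → J (f x) → J x
    f-J⁻ {x} b = subst J (app-flipˡ π x) (g-J b)

    -- If deleting position j takes z out of [p, q], it also takes the value `f z` out, since
    -- deletions reflect [p, q]. But `f z` lies in `J`, and only the endpoints of `J` can be lost.
    endpoint : ∀ {j z} → j ≤ n → z ≢ j → J z → ¬ Between p q (del j z) → f z ≡ p ⊎ f z ≡ suc q
    endpoint {j} {z} j≤n z≢j b ¬b = ¬between-del⇒endpoint (f j) (f z) (f-J b) (λ b′ → ¬b (bwd j≤n z≢j b′))

    J-p : J p
    J-p = ≤-refl , ≤-trans (<⇒≤ p<q) (n≤1+n q)

    J-w : J (suc q)
    J-w = ≤-trans (<⇒≤ p<q) (n≤1+n q) , ≤-refl

    ¬b-w : suc q < n → ¬ Between p q (del n (suc q))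
    ¬b-w w<n b = <⇒≱ ≤-refl (subst (_≤ q) (del-≤ (<⇒≤ w<n)) (proj₂ b))

    ¬b-p : ∀ {p′} → p ≡ suc p′ → ¬ Between p q (del 0 p)
    ¬b-p refl b = <⇒≱ ≤-refl (proj₁ b)

  module Left (p≡0 : p ≡ 0) (w<n : suc q < n) where
    f-w : f (suc q) ≡ suc q
    f-w with endpoint ≤-refl (<⇒≢ w<n) J-w (¬b-w w<n)
    ... | inj₂ e = e
    -- The value 0 is renumbered to 0 by every deletion and stays in [p, q], whereas position q + 1
    -- leaves it when n is deleted.
    ... | inj₁ e = ⊥-elim (¬b-w w<n (bwd ≤-refl (<⇒≢ w<n)
            (subst (Between p q) (sym (trans (cong (del (f n)) (trans e p≡0)) (del-≤ {f n} z≤n)))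
              (≤-reflexive p≡0 , z≤n))))

    t≡w : t ≡ suc q
    t≡w = sym (at-t f-w)

    s≡q : s ≡ q
    s≡q = from-adjacent adj
      where
      from-adjacent : Adjacent s t → s ≡ q
      from-adjacent (inj₂ t≡1+s) = suc-injective (trans (sym t≡1+s) t≡w)
      -- The other neighbour q + 2 of t lies outside `J`, while f s = p lies inside.
      from-adjacent (inj₁ s≡1+t) = contradiction (proj₂ (f-J⁻ {s} (subst J (sym fs) J-p)))
        (<⇒≱ (≤-reflexive (trans (cong suc (sym t≡w)) (sym s≡1+t))))

    f-q : f q ≡ 0
    f-q = trans (cong f (sym s≡q)) (trans fs p≡0)

    -- The point n is outside `J`, so its image is too, and `J` starts at 0. Hence deleting the last
    -- entry renumbers no value in `J`.
    w<fn : suc q < f n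
    w<fn = ≰⇒> λ fn≤w → <⇒≱ w<n (proj₂ (f-J⁻ (subst (_≤ f n) (sym p≡0) z≤n , fn≤w)))

    -- The deletion of the last entry agrees with f on [0, q] and commutes with c there.
    f-pred : ∀ {x} → suc x ≡ q → f x ≡ q
    f-pred {x} 1+x≡q = trans (sym (ρ≗f (≤-trans (n≤1+n x) (≤-reflexive 1+x≡q))))
            (app-injective cπ (begin
              c (app ρ x)  ≡⟨ app-comm comm gc gρ x ⟩
              app ρ (c x)  ≡⟨ cong (app ρ) (trans (IsCycle.step cyc (subst (_≤ x) (sym p≡0) z≤n) (≤-reflexive 1+x≡q)) 1+x≡q) ⟩
              app ρ q      ≡⟨ ρ≗f ≤-refl ⟩
              f q          ≡⟨ trans f-q (sym p≡0) ⟩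
              p            ≡⟨ IsCycle.wrap cyc ⟨
              c q          ∎))
      where
      open ≡-Reasoning
      D = deletion {T} {n} {π} av {n} ≤-refl
      ρ = proj₁ D
      gρ = proj₁ (proj₂ D)
      eq = proj₂ (proj₂ D)
      ρ≗f : ∀ {y} → y ≤ q → app ρ y ≡ f y
      ρ≗f {y} y≤q = trans (cong (app ρ) (sym (del-≤ (<⇒≤ y<n)))) (trans (eq (<⇒≢ y<n))
          (del-≤ (≤-trans (proj₂ (f-J (subst (_≤ y) (sym p≡0) z≤n , ≤-trans y≤q (n≤1+n q)))) (<⇒≤ w<fn))))
        where y<n = ≤-trans (s≤s y≤q) q<n

    -- Otherwise the step from q back to q - 1 yields a shorter cycle, not preserved by c.
    q≡1 : q ≡ 1
    q≡1 = go q refl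
      where
      go : ∀ x → q ≡ x → q ≡ 1
      go zero                e = contradiction (subst (p <_) e p<q) λ ()
      go (suc zero)          e = e
      go x@(suc x′@(suc x″)) e =
        let c′ , gc′ , cyc′ = adjacent-cycle {T} {n} {π} av {q} {x′} {0} {x′} (<⇒≤ q<n)
               (≤-trans (n≤1+n x′) (subst (_≤ n) e (<⇒≤ q<n))) (inj₁ e) f-q (trans (f-pred (sym e)) e) z≤n
        in contradiction
              (subst (_≤ x′) (IsCycle.step cyc (subst (_≤ x′) (sym p≡0) z≤n) (subst (x′ <_) (sym e) ≤-refl))
                (proj₂ (commuting-preserves cyc′ (s≤s z≤n) cπ (app-comm comm gc gc′) {x′} (z≤n , ≤-refl))))
              (<⇒≱ ≤-refl)

  module Right {p′} (p≡ : p ≡ suc p′) (w≡n : suc q ≡ n) where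
    -- This module is the mirror image of `Left` under reversing both positions and values: position
    -- 0 now plays the role of position n.
    f-p : f p ≡ p
    f-p with endpoint z≤n (λ p≡0 → 0≢1+n (trans (sym p≡0) p≡)) J-p (¬b-p p≡)
    ... | inj₁ e = e
    -- If f p = q + 1, then f 0 ≤ q, so deleting position 0 lowers this value to q, inside [p, q],
    -- although position p drops out.
    ... | inj₂ e = ⊥-elim (¬b-p p≡ (bwd z≤n p≢0
            (subst (Between p q) (sym (trans (cong (del (f 0)) e) (del-> f0≤q))) (<⇒≤ p<q , ≤-refl))))
      where
      p≢0 : p ≢ 0
      p≢0 p≡0 = 0≢1+n (trans (sym p≡0) p≡)
      f0≤q : f 0 ≤ q
      f0≤q = ≤-pred (≤∧≢⇒< (subst (f 0 ≤_) (sym w≡n) (f≤ z≤n))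
        (λ e′ → p≢0 (app-injective π (trans e (sym e′)))))

    s≡p : s ≡ p
    s≡p = sym (at-s f-p)

    t≡1+p : t ≡ suc p
    t≡1+p = from-adjacent adj
      where
      from-adjacent : Adjacent s t → t ≡ suc p
      from-adjacent (inj₂ t≡1+s) = trans t≡1+s (cong suc s≡p)
      from-adjacent (inj₁ s≡1+t) = contradiction (proj₁ (f-J⁻ {t} (subst J (sym ft) J-w)))
        (<⇒≱ (≤-reflexive (trans (sym s≡1+t) s≡p)))

    f-1+p : f (suc p) ≡ suc q
    f-1+p = trans (cong f (sym t≡1+p)) ft

    f0<p : f 0 < p
    f0<p = ≰⇒> λ p≤f0 → contradiction
      (subst (_≤ 0) p≡ (proj₁ (f-J⁻ (p≤f0 , subst (f 0 ≤_) (sym w≡n) (f≤ z≤n))))) λ ()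

    -- The deletion of the first entry is `f` with positions shifted by 1. Commuting with `c` makes
    -- it send p + 1 = c p to c q = p; as f 0 < p, this p is the renumbered value p + 1.
    f-2+p : f (suc (suc p)) ≡ suc p
    f-2+p = descend (del-cases (f 0) (f (suc (suc p))))
      where
      open ≡-Reasoning
      D = deletion {T} {n} {π} av {0} z≤n
      ρ = proj₁ D
      gρ = proj₁ (proj₂ D)
      eq = proj₂ (proj₂ D)
      del≡p : del (f 0) (f (suc (suc p))) ≡ p
      del≡p = begin
        del (f 0) (f (suc (suc p)))  ≡⟨ eq {suc (suc p)} (λ ()) ⟨
        app ρ (suc p)                ≡⟨ cong (app ρ) (IsCycle.step cyc ≤-refl p<q) ⟨
        app ρ (c p)                  ≡⟨ app-comm comm gc gρ p ⟨
        c (app ρ p)                  ≡⟨ cong c (eq {suc p} (λ ())) ⟩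
        c (del (f 0) (f (suc p)))    ≡⟨ cong (c ∘ del (f 0)) f-1+p ⟩
        c (del (f 0) (suc q))        ≡⟨ cong c (del-> (≤-trans (<⇒≤ f0<p) (<⇒≤ p<q))) ⟩
        c q                          ≡⟨ IsCycle.wrap cyc ⟩
        p                            ∎
      descend : _ → f (suc (suc p)) ≡ suc p
      descend (inj₂ (y , e , _ , e′)) = trans e (cong suc (trans (sym e′) del≡p))
      descend (inj₁ (e , le)) = contradiction (≤-trans (≤-reflexive (trans (sym del≡p) e)) le) (<⇒≱ f0<p)

    -- Otherwise the step from position p + 2 back to p + 1 yields a cycle on [p + 1, q]. That
    -- interval is not preserved by `c`, which sends q to p.
    q≡1+p : q ≡ suc p
    q≡1+p with m≤n⇒m<n∨m≡n p<q
    ... | inj₂ e = sym e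
    ... | inj₁ 1+p<q =
      let c′ , gc′ , cyc′ = adjacent-cycle {T} {n} {π} av {suc (suc p)} {suc p} {suc p} {q}
             (≤-trans 1+p<q (<⇒≤ q<n)) (≤-trans p<q (<⇒≤ q<n)) (inj₁ refl) f-2+p f-1+p p<q
      in contradiction
            (subst (suc p ≤_) (IsCycle.wrap cyc)
              (proj₁ (commuting-preserves cyc′ 1+p<q cπ (app-comm comm gc gc′) {q} (p<q , ≤-refl))))
            (<⇒≱ ≤-refl)

  AtLeft AtRight : Set
  AtLeft  = p ≡ 0 × q ≡ 1 × s ≡ 1 × t ≡ 2 × f 0 ≡ 1 × f 1 ≡ 0 × f 2 ≡ 2
  AtRight = n ≡ suc (suc p) × q ≡ suc p × s ≡ p × t ≡ suc p ×
            f p ≡ p × f (suc p) ≡ suc (suc p) × f (suc (suc p)) ≡ suc p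

  atLeft⊎atRight : AtLeft ⊎ AtRight
  atLeft⊎atRight = by-cases p refl (m≤n⇒m<n∨m≡n q<n)
    where
    by-cases : ∀ x → p ≡ x → suc q < n ⊎ suc q ≡ n → AtLeft ⊎ AtRight
    by-cases zero p≡0 (inj₁ w<n) = inj₁ (p≡0 , q≡1 , trans s≡q q≡1 , trans t≡w (cong suc q≡1) ,
        trans (f-pred (sym q≡1)) q≡1 , trans (cong f (sym q≡1)) f-q ,
        trans (cong (f ∘ suc) (sym q≡1)) (trans f-w (cong suc q≡1)))
      where open Left p≡0 w<n
    -- Here `c` is a cycle through all n points.
    by-cases zero p≡0 (inj₂ w≡n) = ⊥-elim (noFull gc (subst (λ x → IsCycle x q c) p≡0 cyc) (sym w≡n))
    by-cases (suc p′) p≡ (inj₂ w≡n) = inj₂ (trans (sym w≡n) (cong suc q≡1+p) , q≡1+p , s≡p , t≡1+p ,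
        f-p , trans f-1+p (cong suc q≡1+p) , f-2+p)
      where open Right p≡ w≡n
    -- Both positions 0 and n lie outside `J`. Deleting them in turn shows that p and q + 1, as
    -- positions, carry the values p and q + 1 in some order, so they would have to be s and t.
    by-cases (suc p′) p≡ (inj₁ w<n) = ⊥-elim (endpoints-not-adjacent adj p<q
      (s⊎t (endpoint z≤n (λ p≡0 → 0≢1+n (trans (sym p≡0) p≡)) J-p (¬b-p p≡)))
      (s⊎t (endpoint ≤-refl (<⇒≢ w<n) J-w (¬b-w w<n))))
      where
      s⊎t : ∀ {z} → f z ≡ p ⊎ f z ≡ suc q → z ≡ s ⊎ z ≡ t
      s⊎t (inj₁ e) = inj₁ (at-s e)
      s⊎t (inj₂ e) = inj₂ (at-t e)

-- Classification of the avoiding permutations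

Short : (ℕ → ℕ) → ℕ → Set
Short g k = g (suc k) ≡ suc (g k) ⊎ g k ≡ suc (g (suc k))

≤-extend : ∀ (P : ℕ → Set) {d} → (∀ {k} → k ≤ d → P k) → P (suc d) → ∀ {k} → k ≤ suc d → P k
≤-extend P below top k≤1+d with m≤n⇒m<n∨m≡n k≤1+d
... | inj₁ (s≤s k≤d) = below k≤d
... | inj₂ refl      = top

-- An injective walk with unit steps cannot turn, since a turn would repeat the value from two steps
-- before. The descending case is stated additively to avoid truncated subtraction.
short-run : (g : ℕ → ℕ) → (∀ {x y} → g x ≡ g y → x ≡ y) → ∀ d → (∀ {k} → k < d → Short g k) →
  (∀ {k} → k ≤ d → g k ≡ k + g 0) ⊎ (∀ {k} → k ≤ d → k + g k ≡ g 0)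
short-run g inj zero short = inj₁ λ { z≤n → refl }
-- The first step fixes the direction; a run of length 0 has none, so length 1 needs its own base
-- case.
short-run g inj (suc zero) short with short {0} (s≤s z≤n)
... | inj₁ up   = inj₁ (≤-extend (λ k → g k ≡ k + g 0) (λ { z≤n → refl }) up)
... | inj₂ down = inj₂ (≤-extend (λ k → k + g k ≡ g 0) (λ { z≤n → refl }) (sym down))
short-run g inj (suc (suc d)) short with short-run g inj (suc d) (λ k<d → short (m<n⇒m<1+n k<d)) | short {suc d} ≤-refl
... | inj₁ ups | inj₁ up = inj₁ (≤-extend (λ k → g k ≡ k + g 0) ups (trans up (cong suc (ups ≤-refl))))
... | inj₁ ups | inj₂ down = contradiction
        (inj (suc-injective (trans (sym down) (trans (ups ≤-refl) (cong suc (sym (ups (n≤1+n d))))))))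
        (>⇒≢ (m<n⇒m<1+n (n<1+n d)))
... | inj₂ downs | inj₁ up = contradiction
        (inj (trans up (+-cancelˡ-≡ d _ _ (trans (+-suc d _) (trans (downs ≤-refl) (sym (downs (n≤1+n d))))))))
        (>⇒≢ (m<n⇒m<1+n (n<1+n d)))
... | inj₂ downs | inj₂ down = inj₂ (≤-extend (λ k → k + g k ≡ g 0) downs
        (trans (sym (+-suc (suc d) _)) (trans (cong (suc d +_) (sym down)) (downs ≤-refl))))

-- Transpositions of adjacent points

swapAt : ℕ → ℕ → ℕ
swapAt zero    zero          = 1
swapAt zero    (suc zero)    = 0
swapAt zero    (suc (suc x)) = suc (suc x)
swapAt (suc m) zero          = zero
swapAt (suc m) (suc x)       = suc (swapAt m x)

swapAt-involutive : ∀ m x → swapAt m (swapAt m x) ≡ x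
swapAt-involutive zero    zero          = refl
swapAt-involutive zero    (suc zero)    = refl
swapAt-involutive zero    (suc (suc x)) = refl
swapAt-involutive (suc m) zero          = refl
swapAt-involutive (suc m) (suc x)       = cong suc (swapAt-involutive m x)

swapAt-comm : ∀ m x → swapAt 0 (swapAt (suc (suc m)) x) ≡ swapAt (suc (suc m)) (swapAt 0 x)
swapAt-comm m zero          = refl
swapAt-comm m (suc zero)    = refl
swapAt-comm m (suc (suc x)) = refl

swapAt-below : ∀ {m x} → x < m → swapAt m x ≡ x
swapAt-below {suc m} {zero}  _         = refl
swapAt-below {suc m} {suc x} (s≤s x<m) = cong suc (swapAt-below x<m)

swapAt-self : ∀ m → swapAt m m ≡ suc m
swapAt-self zero    = refl
swapAt-self (suc m) = cong suc (swapAt-self m)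

swapAt-suc : ∀ m → swapAt m (suc m) ≡ m
swapAt-suc zero    = refl
swapAt-suc (suc m) = cong suc (swapAt-suc m)

swapAt-above : ∀ {m x} → suc m < x → swapAt m x ≡ x
swapAt-above {zero}  {suc (suc x)} _           = refl
swapAt-above {zero}  {suc zero}    (s≤s ())
swapAt-above {suc m} {suc x}       (s≤s 1+m<x) = cong suc (swapAt-above 1+m<x)

_when_ : (ℕ → ℕ) → Bool → ℕ → ℕ
(h when true)  x = h x
(h when false) x = x

-- A long step in length 6 + r leaves an end transposition in the group of length 5 + r.
HasTransposition : PatternSet → ℕ → Set
HasTransposition T r = Σ (Permutation′ (5 + r)) λ c →
  Gen T (5 + r) c × (IsCycle 0 1 (app c) ⊎ IsCycle (3 + r) (4 + r) (app c))

-- Meant for length 6 + r, where 4 + r and 5 + r are the two highest points.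
EndSwaps : ℕ → (ℕ → ℕ) → Set
EndSwaps r h = ∃[ x ] ∃[ y ] ∀ z → h z ≡ (swapAt 0 when x) ((swapAt (4 + r) when y) z)

module Classify {T r} (comm : Commuting T (5 + r)) (noFull : NoFullCycle T (5 + r))
                {π : Permutation′ (6 + r)} (av : Avoids T π) where

  private
    f : ℕ → ℕ
    f = app π

    f≤ : ∀ {x} → x ≤ 5 + r → f x ≤ 5 + r
    f≤ x≤n = ≤-pred (app-< π (s≤s x≤n))

    f-above : ∀ {x} → 6 + r ≤ x → f x ≡ x
    f-above x≥ = app-outside π (≤⇒≯ x≥)

  SwappedLeft SwappedRight : Set
  SwappedLeft  = f 0 ≡ 1 × f 1 ≡ 0 × f 2 ≡ 2
  SwappedRight = f (3 + r) ≡ 3 + r × f (4 + r) ≡ 5 + r × f (5 + r) ≡ 4 + r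

  -- The initial 1 0 2 has its long step between positions 1 and 2, the final n-2 n n-1 between
  -- positions 3 + r and 4 + r.
  LongStepAt : ℕ → Set
  LongStepAt k = HasTransposition T r × (k ≡ 1 × SwappedLeft ⊎ k ≡ 3 + r × SwappedRight)

  -- In both exceptional patterns the long step ascends from left to right. The equation for t
  -- records this, and it rules out long descents.
  long-step : ∀ {s t q} → s ≤ 5 + r → t ≤ 5 + r → Adjacent s t → f t ≡ suc q → f s < q →
    t ≡ suc s × LongStepAt s
  long-step {s} {t} {q} s≤n t≤n adj ft p<q =
    conclude (adjacent-cycle {T} {5 + r} {π} av s≤n t≤n adj refl ft (<⇒≤ p<q)) atLeft⊎atRight
    where
    open LongStep {T} {5 + r} comm noFull {π} av s≤n t≤n adj refl ft p<q
    conclude : Σ (Permutation′ (5 + r)) (λ c → Gen T (5 + r) c × IsCycle (f s) q (app c)) →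
      AtLeft ⊎ AtRight → t ≡ suc s × LongStepAt s
    conclude (c , gc , cyc) (inj₁ (p≡ , q≡ , s≡ , t≡ , f0 , f1 , f2)) =
      trans t≡ (cong suc (sym s≡)) ,
      (c , gc , inj₁ (subst (λ p → IsCycle p 1 (app c)) p≡ (subst (λ q → IsCycle (f s) q (app c)) q≡ cyc))) ,
      inj₁ (s≡ , f0 , f1 , f2)
    conclude (c , gc , cyc) (inj₂ (n≡ , q≡ , s≡ , t≡ , fp , f1+p , f2+p)) =
      trans t≡ (cong suc (sym s≡)) ,
      (c , gc , inj₂ (subst (λ p → IsCycle p (suc p) (app c)) p≡ (subst (λ q → IsCycle (f s) q (app c)) q≡ cyc))) ,
      inj₂ (trans s≡ p≡ ,
        subst (λ p → f p ≡ p × f (suc p) ≡ suc (suc p) × f (suc (suc p)) ≡ suc p) p≡ (fp , f1+p , f2+p))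
      where
      p≡ : f s ≡ 3 + r
      p≡ = sym (suc-injective (suc-injective n≡))

  short⊎long : ∀ {k} → k < 5 + r → Short f k ⊎ LongStepAt k
  short⊎long {k} k<n = by-order (f k) (f (suc k)) refl refl
    where
    by-order : ∀ a b → f k ≡ a → f (suc k) ≡ b → Short f k ⊎ LongStepAt k
    by-order a b fk fk′ with <-cmp a b
    by-order a (suc q) fk fk′ | tri< (s≤s a≤q) _ _ with m≤n⇒m<n∨m≡n a≤q
    ... | inj₂ a≡q = inj₁ (inj₁ (trans fk′ (cong suc (trans (sym a≡q) (sym fk)))))
    ... | inj₁ a<q = inj₂ (proj₂ (long-step (<⇒≤ k<n) k<n (inj₂ refl) fk′ (subst (_< q) (sym fk) a<q)))
    by-order a b fk fk′ | tri≈ _ a≡b _ =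
      contradiction (app-injective π (trans fk′ (trans (sym a≡b) (sym fk)))) 1+n≢n
    by-order (suc q) b fk fk′ | tri> _ _ (s≤s b≤q) with m≤n⇒m<n∨m≡n b≤q
    ... | inj₂ b≡q = inj₁ (inj₂ (trans fk (cong suc (trans (sym b≡q) (sym fk′)))))
    -- A long descent is a long step read from right to left, with s = k + 1 and t = k,
    -- contradicting t = s + 1.
    ... | inj₁ b<q = contradiction
            (proj₁ (long-step k<n (<⇒≤ k<n) (inj₁ refl) fk (subst (_< q) (sym fk′) b<q)))
            (<⇒≢ (m<n⇒m<1+n (n<1+n k)))

  assemble : ∀ x y →
    f 0 ≡ (swapAt 0 when x) 0 → f 1 ≡ (swapAt 0 when x) 1 →
    (∀ {k} → k ≤ 1 + r → f (2 + k) ≡ 2 + k) →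
    f (4 + r) ≡ (swapAt (4 + r) when y) (4 + r) → f (5 + r) ≡ (swapAt (4 + r) when y) (5 + r) →
    EndSwaps r f
  assemble x y f0 f1 mid f4 f5 = x , y , eq
    where
    low : ∀ {z} → z < 4 + r → (swapAt (4 + r) when y) z ≡ z
    low = lemma y
      where
      lemma : ∀ y {z} → z < 4 + r → (swapAt (4 + r) when y) z ≡ z
      lemma true  = swapAt-below
      lemma false = λ _ → refl
    fixed : ∀ z → (swapAt 0 when x) (2 + z) ≡ 2 + z
    fixed z = lemma x
      where
      lemma : ∀ x → (swapAt 0 when x) (2 + z) ≡ 2 + z
      lemma true  = refl
      lemma false = refl
    -- Values of at least 2 are fixed by the lower swap, so it may be applied on the outside at no
    -- cost.
    high : ∀ {z w} → 2 ≤ z → f z ≡ w → w ≡ (swapAt (4 + r) when y) z → 2 ≤ w →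
      f z ≡ (swapAt 0 when x) ((swapAt (4 + r) when y) z)
    high {z} {suc (suc w)} _ fz w≡ _ = trans fz (trans (sym (fixed w)) (cong (swapAt 0 when x) w≡))
    high {z} {suc zero} _ _ _ (s≤s ())
    large : ∀ y {z} → 4 + r ≤ z → 2 ≤ (swapAt (4 + r) when y) z
    large true  {suc (suc z)} _  = s≤s (s≤s z≤n)
    large true  {suc zero} (s≤s ())
    large false z≥ = ≤-trans (s≤s (s≤s z≤n)) z≥
    above : ∀ y {z} → 6 + r ≤ z → z ≡ (swapAt (4 + r) when y) z
    above true  z≥ = sym (swapAt-above z≥)
    above false z≥ = refl
    eq : ∀ z → f z ≡ (swapAt 0 when x) ((swapAt (4 + r) when y) z)
    eq zero       = trans f0 (cong (swapAt 0 when x) (sym (low {0} (s≤s z≤n))))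
    eq (suc zero) = trans f1 (cong (swapAt 0 when x) (sym (low {1} (s≤s (s≤s z≤n)))))
    eq z@(suc (suc k)) with <-cmp z (4 + r) | <-cmp z (5 + r)
    ... | tri< (s≤s (s≤s (s≤s k≤1+r))) _ _ | _ =
      high (s≤s (s≤s z≤n)) (mid k≤1+r) (sym (low (s≤s (s≤s (s≤s k≤1+r))))) (s≤s (s≤s z≤n))
    ... | tri≈ _ refl _ | _ = high (s≤s (s≤s z≤n)) f4 refl (large y ≤-refl)
    ... | tri> _ _ _ | tri≈ _ refl _ = high (s≤s (s≤s z≤n)) f5 refl (large y (n≤1+n _))
    ... | tri> _ _ _ | tri> _ _ z>n = high (s≤s (s≤s z≤n)) (f-above z>n) (above y z>n) (s≤s (s≤s z≤n))
    ... | tri> _ _ z> | tri< z< _ _ = contradiction z> (≤⇒≯ (≤-pred z<))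

  Straight : Set
  Straight = (∀ z → f z ≡ z) ⊎ (∀ z → f z ≡ app (reverse {6 + r}) z)

  reversed : (∀ {k} → k ≤ 5 + r → k + f k ≡ 5 + r) → ∀ z → f z ≡ app (reverse {6 + r}) z
  reversed sum = by-toℕ (6 + r) _
    (λ i → trans (trans (sym (m+n∸m≡n (toℕ i) (f (toℕ i)))) (cong (_∸ toℕ i) (sum (≤-pred (FinP.toℕ<n i)))))
      (sym (trans (app-toℕ (reverse {6 + r}) i) (FinP.opposite-prop i))))
    (λ z≮ → trans (app-outside π z≮) (sym (app-outside (reverse {6 + r}) z≮)))

  -- Only the steps at positions 1 and 3 + r can be long. In each of the four combinations the
  -- remaining stretches are monotone runs, and their direction and offset are forced by the known
  -- entries or by the range of values.
  classify : Straight ⊎ (HasTransposition T r × EndSwaps r f)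
  classify = by-steps (short⊎long (s≤s (s≤s z≤n))) (short⊎long (n≤1+n (4 + r)))
    where
    inj-f : ∀ {x y} → f x ≡ f y → x ≡ y
    inj-f = app-injective π

    inj-f2 : ∀ {x y} → f (2 + x) ≡ f (2 + y) → x ≡ y
    inj-f2 = suc-injective ∘ suc-injective ∘ app-injective π

    short-at : ∀ {k} → k < 5 + r → (k ≡ 1 → Short f k) → (k ≡ 3 + r → Short f k) → Short f k
    short-at k<n at1 at3 with short⊎long k<n
    ... | inj₁ short                = short
    ... | inj₂ (_ , inj₁ (k≡1 , _)) = at1 k≡1
    ... | inj₂ (_ , inj₂ (k≡ , _))  = at3 k≡

    after-left : SwappedLeft → ∀ {d} → 1 ≤ d →
      (∀ {k} → k < d → Short (λ k → f (2 + k)) k) → ∀ {k} → k ≤ d → f (2 + k) ≡ 2 + k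
    after-left (f0 , f1 , f2) {d} 1≤d short with short-run (λ k → f (2 + k)) inj-f2 d short
    ... | inj₁ ups   = λ k≤d → trans (ups k≤d) (trans (cong (_ +_) f2) (+-comm _ 2))
    -- A descent from f 2 = 2 would give f 3 = 1, which is already the value of f 0.
    ... | inj₂ downs = contradiction (inj-f {3} {0} (trans (suc-injective (trans (downs 1≤d) f2)) (sym f0))) λ ()

    by-steps : Short f 1 ⊎ LongStepAt 1 → Short f (3 + r) ⊎ LongStepAt (3 + r) →
      Straight ⊎ (HasTransposition T r × EndSwaps r f)
    by-steps (inj₂ (W , inj₁ (_ , L@(f0 , f1 , f2)))) (inj₂ (_ , inj₂ (_ , _ , f4 , f5))) =
      inj₂ (W , assemble true true f0 f1
        (after-left L (s≤s z≤n) λ { (s≤s k≤r) → short-at (s≤s (s≤s (s≤s (m≤n⇒m≤1+n (m≤n⇒m≤1+n k≤r)))))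
          (λ ()) (λ e → contradiction (suc-injective (suc-injective e)) (<⇒≢ (s≤s k≤r))) })
        (trans f4 (sym (swapAt-self (4 + r)))) (trans f5 (sym (swapAt-suc (4 + r)))))
    by-steps (inj₂ (W , inj₁ (_ , L@(f0 , f1 , f2)))) (inj₁ short3) =
      inj₂ (W , assemble true false f0 f1 (λ k≤ → mid (≤-trans k≤ (m≤n+m (1 + r) 2)))
        (mid (n≤1+n (2 + r))) (mid ≤-refl))
      where
      mid : ∀ {k} → k ≤ 3 + r → f (2 + k) ≡ 2 + k
      mid = after-left L (s≤s z≤n) λ k<d → short-at (s≤s (s≤s k<d)) (λ ()) λ { refl → short3 }
    by-steps (inj₁ short1) (inj₂ (W , inj₂ (_ , f3 , f4 , f5)))
      with short-run f inj-f (3 + r) (λ k<d → short-at (≤-trans k<d (m≤n+m (3 + r) 2))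
             (λ { refl → short1 }) (λ e → contradiction e (<⇒≢ k<d)))
    ... | inj₁ ups = inj₂ (W , assemble false true f0 (trans (ups (s≤s z≤n)) (cong suc f0))
            (λ {k} k≤ → trans (ups (s≤s (s≤s k≤))) (trans (cong (2 + k +_) f0) (+-identityʳ (2 + k))))
            (trans f4 (sym (swapAt-self (4 + r)))) (trans f5 (sym (swapAt-suc (4 + r)))))
      where
      f0 : f 0 ≡ 0
      f0 = +-cancelˡ-≡ (3 + r) _ _ (trans (sym (ups ≤-refl)) (trans f3 (sym (+-identityʳ (3 + r)))))
    -- A descending run ending in f (3 + r) = 3 + r would start at 6 + 2r, beyond the largest value
    -- 5 + r.
    ... | inj₂ downs = contradiction (f≤ {0} z≤n) (<⇒≱ (subst (5 + r <_) (trans (cong (3 + r +_) (sym f3)) (downs ≤-refl))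
            (subst (_≤ 3 + r + (3 + r)) (+-comm (3 + r) 3) (+-monoʳ-≤ (3 + r) (m≤m+n 3 r)))))
    by-steps (inj₁ short1) (inj₁ short3)
      with short-run f inj-f (5 + r) (λ k<d → short-at k<d (λ { refl → short1 }) (λ { refl → short3 }))
    ... | inj₁ ups = inj₁ (inj₁ identity)
      where
      f0 : f 0 ≡ 0
      f0 = n≤0⇒n≡0 (+-cancelˡ-≤ (5 + r) _ _ (subst (_≤ 5 + r + 0) (ups ≤-refl)
             (subst (f (5 + r) ≤_) (sym (+-identityʳ (5 + r))) (f≤ ≤-refl))))
      identity : ∀ z → f z ≡ z
      identity z with z ≤? 5 + r
      ... | yes z≤5+r = trans (ups z≤5+r) (trans (cong (z +_) f0) (+-identityʳ z))
      ... | no  z≰5+r = f-above (≰⇒> z≰5+r)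
    ... | inj₂ downs = inj₁ (inj₂ (reversed λ k≤n → trans (downs k≤n) f0))
      where
      f0 : f 0 ≡ 5 + r
      f0 = ≤-antisym (f≤ {0} z≤n) (subst (5 + r ≤_) (downs ≤-refl) (m≤m+n (5 + r) _))
    by-steps (inj₂ (_ , inj₂ (1≡ , _))) _ = contradiction (suc-injective 1≡) λ ()
    by-steps _ (inj₂ (_ , inj₁ (≡1 , _))) = contradiction (suc-injective ≡1) λ ()

  -- Deleting the first entry of the reversal leaves a group element exchanging 0 and 4 + r. It
  -- preserves neither [0, 1] nor [3 + r, 4 + r], so it cannot commute with an end transposition.
  reverse-excludes-transposition : (∀ z → f z ≡ app (reverse {6 + r}) z) → HasTransposition T r → ⊥
  reverse-excludes-transposition rev (c , gc , cycle) = by-end cycle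
    where
    D = deletion {T} {5 + r} {π} av {0} z≤n
    ρ = proj₁ D
    gρ = proj₁ (proj₂ D)
    eq = proj₂ (proj₂ D)
    f-rev : ∀ (i : Fin (6 + r)) → f (toℕ i) ≡ 5 + r ∸ toℕ i
    f-rev i = trans (rev (toℕ i)) (trans (app-toℕ (reverse {6 + r}) i) (FinP.opposite-prop i))
    f5 : f (5 + r) ≡ 0
    f5 = trans (cong f (sym (FinP.toℕ-fromℕ (5 + r)))) (trans (f-rev (Fin.fromℕ (5 + r)))
           (trans (cong (5 + r ∸_) (FinP.toℕ-fromℕ (5 + r))) (n∸n≡0 (5 + r))))
    ρ0 : app ρ 0 ≡ 4 + r
    ρ0 = trans (eq {1} (λ ())) (trans (cong₂ del (f-rev fzero) (f-rev (fsuc fzero))) (del-≤ (n≤1+n (4 + r))))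
    ρ4 : app ρ (4 + r) ≡ 0
    ρ4 = trans (eq {5 + r} (λ ())) (cong (del (f 0)) f5)
    by-end : _ → ⊥
    by-end (inj₁ cyc) = contradiction (subst (_≤ 1) ρ0
      (proj₂ (commuting-preserves cyc (s≤s z≤n) ρ (app-comm comm gρ gc) (z≤n , z≤n)))) λ { (s≤s ()) }
    by-end (inj₂ cyc) = contradiction (subst (3 + r ≤_) ρ4
      (proj₁ (commuting-preserves cyc ≤-refl ρ (app-comm comm gρ gc) (n≤1+n (3 + r) , ≤-refl)))) λ ()

-- Klein four-groups

Involutive : (ℕ → ℕ) → Set
Involutive h = ∀ z → h (h z) ≡ z

when-xor : ∀ {h} → Involutive h → ∀ x x′ z → (h when x) ((h when x′) z) ≡ (h when (x xor x′)) z
when-xor h² true  true  z = h² z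
when-xor h² true  false z = refl
when-xor h² false x′    z = refl

when-comm : ∀ {a b} → (∀ z → a (b z) ≡ b (a z)) → ∀ x y z → (a when x) ((b when y) z) ≡ (b when y) ((a when x) z)
when-comm ab true  true  z = ab z
when-comm ab true  false z = refl
when-comm ab false y     z = refl

module Klein (a b : ℕ → ℕ) (a² : Involutive a) (b² : Involutive b) (ab : ∀ z → a (b z) ≡ b (a z)) where

  elt : Bool → Bool → ℕ → ℕ
  elt x y z = (a when x) ((b when y) z)

  elt-∘ : ∀ x y x′ y′ z → elt x y (elt x′ y′ z) ≡ elt (x xor x′) (y xor y′) z
  elt-∘ x y x′ y′ z = begin
    (a when x) ((b when y) ((a when x′) ((b when y′) z)))    ≡⟨ cong (a when x) (when-comm {a} {b} ab x′ y _) ⟨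
    (a when x) ((a when x′) ((b when y) ((b when y′) z)))    ≡⟨ when-xor a² x x′ _ ⟩
    (a when (x xor x′)) ((b when y) ((b when y′) z))         ≡⟨ cong (a when (x xor x′)) (when-xor b² y y′ z) ⟩
    (a when (x xor x′)) ((b when (y xor y′)) z)              ∎
    where open ≡-Reasoning

  elt-involutive : ∀ x y → Involutive (elt x y)
  elt-involutive x y z = trans (elt-∘ x y x y z) (cong₂ (λ u v → elt u v z) (xor-same x) (xor-same y))

  Member : (ℕ → ℕ) → Set
  Member h = ∃[ x ] ∃[ y ] ∀ z → h z ≡ elt x y z

  -- The alternative `Q` is an escape: a generator outside the four-group may deliver a witness of
  -- `Q` instead, and one such witness settles the whole word.
  generated-member : ∀ {T n} {Q : Set} →
    (∀ {π : Permutation′ n} → Avoids T π → Member (app π) ⊎ Q) →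
    ∀ {h : Permutation′ n} → Gen T n h → Member (app h) ⊎ Q
  generated-member base (gen av) = base av
  generated-member {n = n} base one = inj₁ (false , false , app-id {n})
  generated-member base (mul {π} {σ} gπ gσ) with generated-member base gπ | generated-member base gσ
  ... | inj₂ q | _ = inj₂ q
  ... | inj₁ _ | inj₂ q = inj₂ q
  ... | inj₁ (x , y , eπ) | inj₁ (x′ , y′ , eσ) = inj₁ (x xor x′ , y xor y′ , λ z →
        trans (app-· π σ z) (trans (eπ _) (trans (cong (elt x y) (eσ z)) (elt-∘ x y x′ y′ z))))
  generated-member base (inv {π} gπ) with generated-member base gπ
  ... | inj₂ q = inj₂ q
  ... | inj₁ (x , y , eπ) = inj₁ (x , y , λ z →
        app-injective π (trans (app-flipʳ π z) (sym (trans (eπ _) (elt-involutive x y z)))))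

  member-involutive : ∀ {h} → Member h → Involutive h
  member-involutive (x , y , e) z = trans (e _) (trans (cong (elt x y) (e z)) (elt-involutive x y z))

-- Powers of a cycle

power : ∀ {n} → Permutation′ n → ℕ → Permutation′ n
power c zero    = id
power c (suc k) = c · power c k

power-gen : ∀ {T n} {c : Permutation′ n} → Gen T n c → ∀ k → Gen T n (power c k)
power-gen gc zero    = one
power-gen gc (suc k) = mul gc (power-gen gc k)

power-cycle : ∀ {n} {c : Permutation′ n} {q} → IsCycle 0 q (app c) → ∀ {k} → k ≤ q → app (power c k) 0 ≡ k
power-cycle {n} cyc {zero} _ = app-id {n} 0
power-cycle {c = c} cyc {suc k} k<q = trans (app-· c (power c k) 0)
  (trans (cong (app c) (power-cycle cyc (<⇒≤ k<q))) (IsCycle.step cyc z≤n k<q))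

-- Abelian groups of exponent two with at most four elements

≅ᵍ-inverse : ∀ {a b ℓ₁ ℓ₂} {H : Group a ℓ₁} {G : Group b ℓ₂} → H ≅ᵍ G → G ≅ᵍ H
≅ᵍ-inverse {H = H} {G} (F , iso) = ψ , record
  { isGroupMonomorphism = record
    { isGroupHomomorphism = record
      { isMonoidHomomorphism = record
        { isMagmaHomomorphism = record
          { isRelHomomorphism = record
            { cong = λ y≈y′ → I.injective (G.trans (Fψ _) (G.trans y≈y′ (G.sym (Fψ _)))) }
          ; homo = λ x y → I.injective (G.trans (Fψ _) (G.sym
                     (G.trans (I.∙-homo _ _) (G.∙-cong (Fψ x) (Fψ y))))) }
        ; ε-homo = I.injective (G.trans (Fψ _) (G.sym I.ε-homo)) }
      ; ⁻¹-homo = λ x → I.injective (G.trans (Fψ _) (G.sym (G.trans (I.⁻¹-homo _) (G.⁻¹-cong (Fψ x))))) }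
    ; injective = λ {x} {y} e → G.trans (G.sym (Fψ x)) (G.trans (I.⟦⟧-cong e) (Fψ y)) }
  ; surjective = λ x → F x , λ z≈Fx → I.injective (G.trans (Fψ _) z≈Fx) }
  where
  module H = Group H
  module G = Group G
  module I = GroupMorphisms.IsGroupIsomorphism iso
  ψ : G.Carrier → H.Carrier
  ψ y = proj₁ (I.surjective y)
  Fψ : ∀ y → F (ψ y) G.≈ y
  Fψ y = proj₂ (I.surjective y) H.refl

xor-false⇒≡ : ∀ x y → x xor y ≡ false → x ≡ y
xor-false⇒≡ true  true  _ = refl
xor-false⇒≡ false false _ = refl

module ElementaryAbelian {c ℓ} (G : AbelianGroup c ℓ) where
  open AbelianGroup G hiding (refl; sym; trans)
  private module ≈ = AbelianGroup G
  open import Algebra.Properties.Group group using (inverseˡ-unique)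
  open import Algebra.Properties.CommutativeSemigroup commutativeSemigroup using (interchange)
  open import Relation.Binary.Reasoning.Setoid setoid

  _^_ : Carrier → Bool → Carrier
  g ^ true  = g
  g ^ false = ε

  module _ (exponent2 : ∀ x → x ∙ x ≈ ε) where

    self-inverse : ∀ x → x ≈ x ⁻¹
    self-inverse x = inverseˡ-unique x x (exponent2 x)

    ^-xor : ∀ g x y → g ^ (x xor y) ≈ g ^ x ∙ g ^ y
    ^-xor g true  true  = ≈.sym (exponent2 g)
    ^-xor g true  false = ≈.sym (identityʳ g)
    ^-xor g false y     = ≈.sym (identityˡ _)

    module _ (g : Carrier) (g≉ε : ¬ g ≈ ε) where

      ℤ₂-iso : (∀ x → x ≈ ε ⊎ x ≈ g) → group ≅ᵍ AbelianGroup.group ℤ₂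
      ℤ₂-iso cover = ≅ᵍ-inverse {H = AbelianGroup.group ℤ₂} {group} (g ^_ , record
        { isGroupMonomorphism = record
          { isGroupHomomorphism = record
            { isMonoidHomomorphism = record
              { isMagmaHomomorphism = record
                { isRelHomomorphism = record { cong = λ e → reflexive (cong (g ^_) e) }
                ; homo = ^-xor g }
              ; ε-homo = ≈.refl }
            ; ⁻¹-homo = λ x → self-inverse (g ^ x) }
          ; injective = λ {x} {y} → inj x y }
        ; surjective = λ y → surj y (cover y) })
        where
        inj : ∀ x y → g ^ x ≈ g ^ y → x ≡ y
        inj true  true  _ = refl
        inj true  false e = contradiction e g≉ε
        inj false true  e = contradiction (≈.sym e) g≉ε
        inj false false _ = refl
        surj : ∀ y → y ≈ ε ⊎ y ≈ g → ∃[ x ] (∀ {z} → z ≡ x → g ^ z ≈ y)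
        surj y (inj₁ e) = false , λ { refl → ≈.sym e }
        surj y (inj₂ e) = true  , λ { refl → ≈.sym e }

      module _ (h : Carrier) (h≉ε : ¬ h ≈ ε) (h≉g : ¬ h ≈ g) where

        span : Bool × Bool → Carrier
        span (x , y) = g ^ x ∙ h ^ y

        span-homo : ∀ x y x′ y′ → span (x xor x′ , y xor y′) ≈ span (x , y) ∙ span (x′ , y′)
        span-homo x y x′ y′ = begin
          g ^ (x xor x′) ∙ h ^ (y xor y′)        ≈⟨ ∙-cong (^-xor g x x′) (^-xor h y y′) ⟩
          (g ^ x ∙ g ^ x′) ∙ (h ^ y ∙ h ^ y′)    ≈⟨ interchange _ _ _ _ ⟩
          (g ^ x ∙ h ^ y) ∙ (g ^ x′ ∙ h ^ y′)    ∎

        span-kernel : ∀ x y → span (x , y) ≈ ε → x ≡ false × y ≡ false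
        span-kernel false false _ = refl , refl
        span-kernel true  false e = contradiction (≈.trans (≈.sym (identityʳ g)) e) g≉ε
        span-kernel false true  e = contradiction (≈.trans (≈.sym (identityˡ h)) e) h≉ε
        -- From gh = ε follows g = h⁻¹ = h.
        span-kernel true  true  e = contradiction
          (≈.trans (self-inverse h) (≈.sym (inverseˡ-unique g h e))) h≉g

        span-injective : ∀ {x y x′ y′} → span (x , y) ≈ span (x′ , y′) → x ≡ x′ × y ≡ y′
        span-injective {x} {y} {x′} {y′} e =
          let xx , yy = span-kernel (x xor x′) (y xor y′) (begin
                span (x xor x′ , y xor y′)          ≈⟨ span-homo x y x′ y′ ⟩
                span (x , y) ∙ span (x′ , y′)       ≈⟨ ∙-congʳ e ⟩
                span (x′ , y′) ∙ span (x′ , y′)     ≈⟨ exponent2 _ ⟩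
                ε                                   ∎)
          in xor-false⇒≡ x x′ xx , xor-false⇒≡ y y′ yy

        ℤ₂×ℤ₂-iso : (∀ z → ∃[ u ] span u ≈ z) → group ≅ᵍ AbelianGroup.group ℤ₂×ℤ₂
        ℤ₂×ℤ₂-iso cover = ≅ᵍ-inverse {H = AbelianGroup.group ℤ₂×ℤ₂} {group} (span , record
          { isGroupMonomorphism = record
            { isGroupHomomorphism = record
              { isMonoidHomomorphism = record
                { isMagmaHomomorphism = record
                  { isRelHomomorphism = record { cong = span-cong }
                  ; homo = λ u v → span-homo (proj₁ u) (proj₂ u) (proj₁ v) (proj₂ v) }
                ; ε-homo = identityˡ ε }
              ; ⁻¹-homo = λ u → self-inverse (span u) }
            ; injective = span-injective }
          ; surjective = λ z → let u , e = cover z in u , λ v≡u → ≈.trans (span-cong v≡u) e })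
          where
          span-cong : ∀ {u v} → proj₁ u ≡ proj₁ v × proj₂ u ≡ proj₂ v → span u ≈ span v
          span-cong (refl , refl) = ≈.refl

        decode : Fin 4 → Bool × Bool
        decode 0F = false , false
        decode 1F = false , true
        decode 2F = true  , false
        decode 3F = true  , true

        encode : Bool × Bool → Fin 4
        encode (false , false) = 0F
        encode (false , true)  = 1F
        encode (true  , false) = 2F
        encode (true  , true)  = 3F

        decode-encode : ∀ u → decode (encode u) ≡ u
        decode-encode (false , false) = refl
        decode-encode (false , true)  = refl
        decode-encode (true  , false) = refl
        decode-encode (true  , true)  = refl

        encode-decode : ∀ i → encode (decode i) ≡ i
        encode-decode 0F = refl
        encode-decode 1F = refl
        encode-decode 2F = refl
        encode-decode 3F = refl

        -- χ need not respect ≈; injectivity makes any five elements collide.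
        span-surjective : (χ : Carrier → Bool × Bool) → (∀ {x y} → χ x ≡ χ y → x ≈ y) →
          ∀ z → ∃[ u ] span u ≈ z
        span-surjective χ χ-injective z = collide (FinP.pigeonhole ≤-refl (encode ∘ χ ∘ five))
          where
          five : Fin 5 → Carrier
          five fzero    = z
          five (fsuc i) = span (decode i)
          equal : ∀ {i j} → encode (χ (five i)) ≡ encode (χ (five j)) → five i ≈ five j
          equal e = χ-injective (trans (sym (decode-encode _)) (trans (cong decode e) (decode-encode _)))
          collide : _ → ∃[ u ] span u ≈ z
          collide (fzero , fsuc j , _ , e) = decode j , ≈.sym (equal {fzero} {fsuc j} e)
          -- The four products are pairwise distinct, so a collision has to involve z.
          collide (fsuc i , fsuc j , s≤s i<j , e) =
            let xx , yy = span-injective (equal {fsuc i} {fsuc j} e)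
            in contradiction (cong toℕ (trans (sym (encode-decode i))
                 (trans (cong encode (cong₂ _,_ xx yy)) (encode-decode j)))) (<⇒≢ i<j)

    -- The enumeration makes the equality of G decidable, so an element outside {ε, g} can be
    -- searched for. If there is none, G has order 2; if there is one, it spans with g a four-group,
    -- and `χ` leaves room for no more elements.
    ℤ₂⊎ℤ₂×ℤ₂ : FiniteGroup group → NontrivialGroup group →
      (χ : Carrier → Bool × Bool) → (∀ {x y} → χ x ≡ χ y → x ≈ y) →
      (group ≅ᵍ AbelianGroup.group ℤ₂) ⊎ (group ≅ᵍ AbelianGroup.group ℤ₂×ℤ₂)
    ℤ₂⊎ℤ₂×ℤ₂ (m , e , e-inj , e-surj) (g , g≉ε) χ χ-injective =
      decide (FinP.any? (λ i → ¬? (e i ≈? ε) ×-dec ¬? (e i ≈? g)))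
      where
      index : Carrier → Fin m
      index x = proj₁ (e-surj x)
      e-index : ∀ x → e (index x) ≈ x
      e-index x = proj₂ (e-surj x) refl
      _≈?_ : ∀ x y → Dec (x ≈ y)
      x ≈? y = map′
        (λ eq → ≈.trans (≈.sym (e-index x)) (≈.trans (reflexive (cong e eq)) (e-index y)))
        (λ x≈y → e-inj (≈.trans (e-index x) (≈.trans x≈y (≈.sym (e-index y)))))
        (index x FinP.≟ index y)
      decide : Dec (∃[ i ] (¬ e i ≈ ε × ¬ e i ≈ g)) →
        (group ≅ᵍ AbelianGroup.group ℤ₂) ⊎ (group ≅ᵍ AbelianGroup.group ℤ₂×ℤ₂)
      decide (yes (i , h≉ε , h≉g)) = inj₂ (ℤ₂×ℤ₂-iso g g≉ε (e i) h≉ε h≉g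
        (span-surjective g g≉ε (e i) h≉ε h≉g χ χ-injective))
      decide (no none) = inj₁ (ℤ₂-iso g g≉ε cover)
        where
        cover : ∀ x → x ≈ ε ⊎ x ≈ g
        cover x with x ≈? ε | x ≈? g
        ... | yes x≈ε | _       = inj₁ x≈ε
        ... | no  _   | yes x≈g = inj₂ x≈g
        ... | no  x≉ε | no  x≉g = contradiction
          (index x , (λ eq → x≉ε (≈.trans (≈.sym (e-index x)) eq)) , (λ eq → x≉g (≈.trans (≈.sym (e-index x)) eq))) none

-- Transfer between G and the generated permutation groups

-- Over a finite index set the choice between `P` everywhere and one witness of `Q` is constructive,
-- so `Q` need not be decided.
collect : ∀ {m} {P : Fin m → Set} {Q : Set} → (∀ i → P i ⊎ Q) → (∀ i → P i) ⊎ Q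
collect {zero}  _ = inj₁ λ ()
collect {suc m} {P} h with h fzero | collect {m} {P ∘ fsuc} (h ∘ fsuc)
... | inj₂ q | _       = inj₂ q
... | inj₁ _ | inj₂ q  = inj₂ q
... | inj₁ p | inj₁ ps = inj₁ λ { fzero → p ; (fsuc i) → ps i }

module _ {c ℓ} (T : PatternSet) (G : AbelianGroup c ℓ) where
  open AbelianGroup G using (Carrier; _≈_; _∙_; ε; comm; ∙-cong; reflexive)
  private module ≈ = AbelianGroup G

  iso⇒commuting : ∀ {n} → genGroup T n ≅ᵍ AbelianGroup.group G → Commuting T n
  iso⇒commuting (φ , iso) gx gy = I.injective {_ , mul gx gy} {_ , mul gy gx}
    (≈.trans (I.∙-homo (_ , gx) (_ , gy)) (≈.trans (comm _ _) (≈.sym (I.∙-homo (_ , gy) (_ , gx)))))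
    where module I = GroupMorphisms.IsGroupIsomorphism iso

  -- The first n powers of an n-cycle send 0 to n different points, hence are distinct. By the
  -- pigeonhole principle they do not fit into a group with fewer than n elements.
  iso⇒noFullCycle : ∀ {n} (fin : FiniteGroup (AbelianGroup.group G)) → proj₁ fin < n →
    genGroup T n ≅ᵍ AbelianGroup.group G → NoFullCycle T n
  iso⇒noFullCycle (m , e , _ , e-surj) m<n (φ , iso) {c} {q} gc cyc refl =
    let i , j , i<j , eq = FinP.pigeonhole m<n (index ∘ φ ∘ pow)
        φi≈φj = ≈.trans (≈.sym (e-index (φ (pow i)))) (≈.trans (reflexive (cong e eq)) (e-index (φ (pow j))))
    in <⇒≢ i<j (trans (sym (at0 i)) (trans
         (app-cong {π = power c (toℕ i)} {power c (toℕ j)} (I.injective {pow i} {pow j} φi≈φj) 0) (at0 j)))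
    where
    module I = GroupMorphisms.IsGroupIsomorphism iso
    index : Carrier → Fin m
    index x = proj₁ (e-surj x)
    e-index : ∀ x → e (index x) ≈ x
    e-index x = proj₂ (e-surj x) refl
    pow : Fin (suc q) → Σ (Permutation′ (suc q)) (Gen T (suc q))
    pow i = power c (toℕ i) , power-gen gc (toℕ i)
    at0 : ∀ i → app (power c (toℕ i)) 0 ≡ toℕ i
    at0 i = power-cycle {c = c} cyc (≤-pred (FinP.toℕ<n i))

  module _ (fin : FiniteGroup (AbelianGroup.group G)) (nontrivial : NontrivialGroup (AbelianGroup.group G))
           {N} (iso : genGroup T N ≅ᵍ AbelianGroup.group G) where
    private
      m = proj₁ fin
      e = proj₁ (proj₂ fin)
      φ = proj₁ iso
      module I = GroupMorphisms.IsGroupIsomorphism (proj₂ iso)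
      index : Carrier → Fin m
      index x = proj₁ (proj₂ (proj₂ (proj₂ fin)) x)
      e-index : ∀ x → e (index x) ≈ x
      e-index x = proj₂ (proj₂ (proj₂ (proj₂ fin)) x) refl

    -- Indexing by `Fin m` instead of `Carrier` leaves finitely many permutations to examine, as
    -- `collect` requires.
    preimage : Fin m → Σ (Permutation′ N) (Gen T N)
    preimage i = proj₁ (I.surjective (e i))

    φ-preimage : ∀ i → φ (preimage i) ≈ e i
    φ-preimage i = proj₂ (I.surjective (e i)) λ _ → refl

    perm : Carrier → Permutation′ N
    perm x = proj₁ (preimage (index x))

    φ-perm : ∀ x → φ (preimage (index x)) ≈ x
    φ-perm x = ≈.trans (φ-preimage (index x)) (e-index x)

    module _ {a b : ℕ → ℕ} (a² : Involutive a) (b² : Involutive b) (ab : ∀ z → a (b z) ≡ b (a z)) where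
      open Klein a b a² b² ab

      -- Each element of G is the image of a permutation in the four-group. Exponent 2 is inherited
      -- through the isomorphism, and the two bits of that permutation determine the element.
      klein⇒ℤ₂⊎ℤ₂×ℤ₂ : (∀ i → Member (app (proj₁ (preimage i)))) →
        (AbelianGroup.group G ≅ᵍ AbelianGroup.group ℤ₂) ⊎ (AbelianGroup.group G ≅ᵍ AbelianGroup.group ℤ₂×ℤ₂)
      klein⇒ℤ₂⊎ℤ₂×ℤ₂ member = ElementaryAbelian.ℤ₂⊎ℤ₂×ℤ₂ G exponent2 fin nontrivial χ χ-injective
        where
        exponent2 : ∀ x → x ∙ x ≈ ε
        exponent2 x = ≈.trans (∙-cong (≈.sym (φ-perm x)) (≈.sym (φ-perm x)))
          (≈.trans (≈.sym (I.∙-homo h h)) (≈.trans (I.⟦⟧-cong {h ∙′ h} {id , one} h²) I.ε-homo))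
          where
          _∙′_ = Group._∙_ (genGroup T N)
          h = preimage (index x)
          h² : (perm x · perm x) ≋ id
          h² = app-reflects-≋ {π = perm x · perm x} {id} λ z → trans (app-· (perm x) (perm x) z)
            (trans (member-involutive (member (index x)) z) (sym (app-id {N} z)))
        χ : Carrier → Bool × Bool
        χ x = proj₁ (member (index x)) , proj₁ (proj₂ (member (index x)))
        χ-injective : ∀ {x y} → χ x ≡ χ y → x ≈ y
        χ-injective {x} {y} eq = ≈.trans (≈.sym (φ-perm x)) (≈.trans
          (I.⟦⟧-cong {preimage (index x)} {preimage (index y)} (app-reflects-≋ {π = perm x} {perm y} λ z →
            trans (proj₂ (proj₂ (member (index x))) z)
              (trans (cong (λ u → elt (proj₁ u) (proj₂ u) z) eq) (sym (proj₂ (proj₂ (member (index y))) z)))))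
          (φ-perm y))

theorem5p4 : ∀ {c ℓ} (T : PatternSet) (G : AbelianGroup c ℓ) →
    FiniteGroup (AbelianGroup.group G) →
    NontrivialGroup (AbelianGroup.group G) →
    (∃[ n₀ ] ∀ n → n ≥ n₀ → genGroup T n ≅ᵍ AbelianGroup.group G) →
    (AbelianGroup.group G ≅ᵍ AbelianGroup.group ℤ₂)
    ⊎ (AbelianGroup.group G ≅ᵍ AbelianGroup.group ℤ₂×ℤ₂)
theorem5p4 T G fin nontrivial (n₀ , isos) = conclude
  -- First attempt: every representative is the identity or the reversal. A long step in any
  -- generator met on the way supplies an end transposition instead.
  (collect λ i → Straight.generated-member {T} {6 + r} straight⊎ (proj₂ (preimage T G fin nontrivial iso i)))
  where
  -- This makes both lengths 5 + r and 6 + r at least n₀, and 5 + r larger than the order of G.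
  r = n₀ + proj₁ fin

  iso⁻ : genGroup T (5 + r) ≅ᵍ AbelianGroup.group G
  iso⁻ = isos (5 + r) (≤-trans (m≤m+n n₀ _) (m≤n+m r 5))

  iso : genGroup T (6 + r) ≅ᵍ AbelianGroup.group G
  iso = isos (6 + r) (≤-trans (m≤m+n n₀ _) (m≤n+m r 6))

  open Classify {T} {r} (iso⇒commuting T G iso⁻)
    (iso⇒noFullCycle T G fin (s≤s (≤-trans (m≤n+m _ n₀) (m≤n+m r 4))) iso⁻)

  rev : ℕ → ℕ
  rev = app (reverse {6 + r})

  rev² : Involutive rev
  rev² = app-flipʳ (reverse {6 + r})

  -- With the identity as second involution, the four-group shrinks to the identity and the
  -- reversal.
  module Straight = Klein rev (λ z → z) rev² (λ _ → refl) (λ _ → refl)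
  module Ends = Klein (swapAt 0) (swapAt (4 + r)) (swapAt-involutive 0) (swapAt-involutive (4 + r)) (swapAt-comm (2 + r))

  straight⊎ : ∀ {π : Permutation′ (6 + r)} → Avoids T π → Straight.Member (app π) ⊎ HasTransposition T r
  straight⊎ {π} av with classify {π} av
  ... | inj₁ (inj₁ idf) = inj₁ (false , false , idf)
  ... | inj₁ (inj₂ rvf) = inj₁ (true , false , rvf)
  ... | inj₂ (W , _)    = inj₂ W

  -- Once one end transposition is known, the reversal is excluded for every avoider, so the escape
  -- becomes empty.
  ends : HasTransposition T r → ∀ {π : Permutation′ (6 + r)} → Avoids T π → Ends.Member (app π) ⊎ ⊥
  ends W {π} av with classify {π} av
  ... | inj₁ (inj₁ idf) = inj₁ (false , false , idf)
  ... | inj₁ (inj₂ rvf) = inj₂ (reverse-excludes-transposition {π} av rvf W)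
  ... | inj₂ (_ , E)    = inj₁ E

  conclude : _ → _
  conclude (inj₁ members) = klein⇒ℤ₂⊎ℤ₂×ℤ₂ T G fin nontrivial iso rev² (λ _ → refl) (λ _ → refl) members
  conclude (inj₂ W) = klein⇒ℤ₂⊎ℤ₂×ℤ₂ T G fin nontrivial iso (swapAt-involutive 0) (swapAt-involutive (4 + r)) (swapAt-comm (2 + r))
    λ i → fromInj₁ ⊥-elim (Ends.generated-member {T} {6 + r} (λ {π} → ends W {π}) (proj₂ (preimage T G fin nontrivial iso i)))
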